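{- Let $m,n\ge 1$ and $a\ge 2$ be integers. If $n\ge 2a+2$ or else $a\ge 2n$, then $\chi_{lt}(mC_6+nP_6+aP_3)=2n+2a+1$. Otherwise: (i) if $n=2a+1$ or else $a\in[n+1,2n-1]$, then $2n+2a+1\le \chi_{lt}(mC_6+nP_6+aP_3)\le 2n+2a+2$; (ii) if $n=2a$ or else $a=n$, then $2n+2a+1\le \chi_{lt}(mC_6+nP_6+aP_3)\le 2n+2a+3$; (iii) if $n\in[a+1,2a-1]$ or else $a=n-1$, then $2n+2a+1\le \chi_{lt}(mC_6+nP_6+aP_3)\le 2n+2a+4$; (iv) if $n\le a$ or else $a\le n-2$, then $2n+2a+1\le \chi_{lt}(mC_6+nP_6+aP_3)\le 2n+2a+5$.
   Context: $[a,b]$ denotes the set of integers $n$ with $a\le n\le b$. $G+H$ is the disjoint union of $G$ and $H$, $mG$ is the disjoint union of $m$ copies of $G$, $P_n$ is the path on $n$ vertices and $C_n$ is the cycle on $n$ vertices. For a finite simple graph $G=(V,E)$ of order $p$ and size $q$, a local total antimagic labeling is a bijection $f:V\cup E\to\{1,\dots,p+q\}$ such that, with weights $w_f(u)=\sum f(e)$ over all edges $e$ incident to $u$ for $u\in V$ (the label of $u$ itself is not included) and $w_f(uv)=f(u)+f(v)$ for $uv\in E$, one has: adjacent vertices have distinct weights, adjacent edges have distinct weights, and every vertex has a weight distinct from that of each of its incident edges. $\chi_{lt}(G)$ is the minimum, over all local total antimagic labelings $f$ of $G$, of the number of distinct values among all the vertex and edge weights. -}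

module Defs where

open import Data.Empty using (⊥-elim)
open import Data.Fin using (Fin; zero; suc; toℕ; inject₁; fromℕ)
open import Data.Fin.Properties
  using (inject₁-injective; toℕ-inject₁; inj⇒≟; +↔⊎; *↔×)
open import Data.List using (List; map; filter; length; deduplicate; allFin; _++_)
open import Data.Nat using (ℕ; zero; suc; _+_; _*_; _≤_; _≤?_; NonZero; _≟_)
open import Data.Nat.ListAction using (sum)
open import Data.Nat.Properties using (m≢1+n+m)
open import Data.Product using (_×_; _,_; proj₁; proj₂; ∃-syntax)
open import Data.Product.Function.NonDependent.Propositional using (_×-↔_)
open import Data.Sum using (_⊎_; inj₁; inj₂)
open import Data.Sum.Function.Propositional using (_⊎-↔_)
open import Data.Sum.Properties using (inj₁-injective; inj₂-injective)
open import Function.Base using (_∘_)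
open import Function.Bundles using (_↔_; _⤖_; Inverse; Bijection)
open import Function.Construct.Identity using (↔-id)
open import Function.Properties.Inverse using (↔-sym; ↔-trans; ↔⇒↣)
open import Relation.Binary.Definitions using (DecidableEquality)
open import Relation.Binary.PropositionalEquality
  using (_≡_; _≢_; refl; sym; trans; cong; cong₂)
open import Relation.Nullary using (Dec)
open import Relation.Nullary.Decidable using (True; _⊎-dec_)

-- A finite simple graph, presented by its incidence structure.  The pair
-- (src e , tgt e) is an arbitrary orientation used only to name the two ends of
-- e; `simple` says that an edge is determined by its unordered pair of ends.
record Graph : Set₁ where
  field
    V E      : Set
    order    : ℕ
    size     : ℕ
    V↔Fin    : V ↔ Fin order
    E↔Fin    : E ↔ Fin size
    src tgt  : E → V
    loopless : ∀ e → src e ≢ tgt e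
    simple   : ∀ {e e′} →
               (src e ≡ src e′ × tgt e ≡ tgt e′) ⊎ (src e ≡ tgt e′ × tgt e ≡ src e′) →
               e ≡ e′

  _≟V_ : DecidableEquality V
  _≟V_ = inj⇒≟ (↔⇒↣ V↔Fin)

  vertices : List V
  vertices = map (Inverse.from V↔Fin) (allFin order)

  edges : List E
  edges = map (Inverse.from E↔Fin) (allFin size)

  Incident : V → E → Set
  Incident u e = u ≡ src e ⊎ u ≡ tgt e

  incident? : ∀ u e → Dec (Incident u e)
  incident? u e = (u ≟V src e) ⊎-dec (u ≟V tgt e)

  AdjacentV : V → V → Set
  AdjacentV u v = u ≢ v × ∃[ e ] (Incident u e × Incident v e)

  AdjacentE : E → E → Set
  AdjacentE e e′ = e ≢ e′ × ∃[ u ] (Incident u e × Incident u e′)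

module _ (G : Graph) where
  open Graph G

  TotalLabeling : Set
  TotalLabeling = (V ⊎ E) ⤖ Fin (order + size)

  -- Fin (p + q) is {0,…,p+q-1}, so labels are shifted to {1,…,p+q}.
  label : TotalLabeling → V ⊎ E → ℕ
  label f x = suc (toℕ (Bijection.to f x))

  weight : TotalLabeling → V ⊎ E → ℕ
  weight f (inj₁ u) = sum (map (label f ∘ inj₂) (filter (incident? u) edges))
  weight f (inj₂ e) = label f (inj₁ (src e)) + label f (inj₁ (tgt e))

  record IsLocalTotalAntimagic (f : TotalLabeling) : Set where
    field
      vertex-vertex : ∀ {u v} → AdjacentV u v → weight f (inj₁ u) ≢ weight f (inj₁ v)
      edge-edge     : ∀ {e e′} → AdjacentE e e′ → weight f (inj₂ e) ≢ weight f (inj₂ e′)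
      vertex-edge   : ∀ {u e} → Incident u e → weight f (inj₁ u) ≢ weight f (inj₂ e)

  weightCount : TotalLabeling → ℕ
  weightCount f = length (deduplicate _≟_
    (map (weight f ∘ inj₁) vertices ++ map (weight f ∘ inj₂) edges))

  -- χₗₜ G = k.  A relation, since a graph need not have any local total
  -- antimagic labeling; such a k is unique when it exists.
  IsχLT : ℕ → Set
  IsχLT k = (∃[ f ] (IsLocalTotalAntimagic f × weightCount f ≡ k))
          × (∀ f → IsLocalTotalAntimagic f → k ≤ weightCount f)

infixr 6 _⊕_
infixr 7 _·_

_⊕_ : Graph → Graph → Graph
G ⊕ H = record
  { V        = G.V ⊎ H.V
  ; E        = G.E ⊎ H.E
  ; order    = G.order + H.order
  ; size     = G.size + H.size
  ; V↔Fin    = ↔-trans (G.V↔Fin ⊎-↔ H.V↔Fin) (↔-sym +↔⊎)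
  ; E↔Fin    = ↔-trans (G.E↔Fin ⊎-↔ H.E↔Fin) (↔-sym +↔⊎)
  ; src      = s
  ; tgt      = t
  ; loopless = λ { (inj₁ e) → G.loopless e ∘ inj₁-injective
                 ; (inj₂ e) → H.loopless e ∘ inj₂-injective }
  ; simple   = λ {e} {e′} → simp e e′
  }
  where
  module G = Graph G
  module H = Graph H
  s t : G.E ⊎ H.E → G.V ⊎ H.V
  s (inj₁ e) = inj₁ (G.src e)
  s (inj₂ e) = inj₂ (H.src e)
  t (inj₁ e) = inj₁ (G.tgt e)
  t (inj₂ e) = inj₂ (H.tgt e)
  simp : ∀ e e′ → (s e ≡ s e′ × t e ≡ t e′) ⊎ (s e ≡ t e′ × t e ≡ s e′) → e ≡ e′
  simp (inj₁ e) (inj₁ e′) (inj₁ (p , q)) = cong inj₁ (G.simple (inj₁ (inj₁-injective p , inj₁-injective q)))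
  simp (inj₁ e) (inj₁ e′) (inj₂ (p , q)) = cong inj₁ (G.simple (inj₂ (inj₁-injective p , inj₁-injective q)))
  simp (inj₂ e) (inj₂ e′) (inj₁ (p , q)) = cong inj₂ (H.simple (inj₁ (inj₂-injective p , inj₂-injective q)))
  simp (inj₂ e) (inj₂ e′) (inj₂ (p , q)) = cong inj₂ (H.simple (inj₂ (inj₂-injective p , inj₂-injective q)))
  simp (inj₁ e) (inj₂ e′) (inj₁ (() , _))
  simp (inj₁ e) (inj₂ e′) (inj₂ (() , _))
  simp (inj₂ e) (inj₁ e′) (inj₁ (() , _))
  simp (inj₂ e) (inj₁ e′) (inj₂ (() , _))

_·_ : ℕ → Graph → Graph
m · G = record
  { V        = Fin m × G.V
  ; E        = Fin m × G.E
  ; order    = m * G.order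
  ; size     = m * G.size
  ; V↔Fin    = ↔-trans (↔-id _ ×-↔ G.V↔Fin) (↔-sym *↔×)
  ; E↔Fin    = ↔-trans (↔-id _ ×-↔ G.E↔Fin) (↔-sym *↔×)
  ; src      = λ (i , e) → i , G.src e
  ; tgt      = λ (i , e) → i , G.tgt e
  ; loopless = λ (_ , e) → G.loopless e ∘ cong proj₂
  ; simple   = λ { (inj₁ (p , q)) → cong₂ _,_ (cong proj₁ p) (G.simple (inj₁ (cong proj₂ p , cong proj₂ q)))
                 ; (inj₂ (p , q)) → cong₂ _,_ (cong proj₁ p) (G.simple (inj₂ (cong proj₂ p , cong proj₂ q))) }
  }
  where
  module G = Graph G

private
  inject₁≢suc : ∀ {k} {i : Fin k} → inject₁ i ≢ suc i
  inject₁≢suc {i = i} p = m≢1+n+m (toℕ i) {0} (trans (sym (toℕ-inject₁ i)) (cong toℕ p))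

  no-swap : ∀ {k} {i j : Fin k} → inject₁ i ≡ suc j → suc i ≢ inject₁ j
  no-swap {i = i} {j} p q = m≢1+n+m (toℕ j) {1}
    (trans (sym (toℕ-inject₁ j))
    (trans (sym (cong toℕ q))
           (cong suc (trans (sym (toℕ-inject₁ i)) (cong toℕ p)))))

-- The path on n vertices 0,…,n-1, with edges {i , i+1}.
P : (n : ℕ) → .{{NonZero n}} → Graph
P (suc k) = record
  { V        = Fin (suc k)
  ; E        = Fin k
  ; order    = suc k
  ; size     = k
  ; V↔Fin    = ↔-id _
  ; E↔Fin    = ↔-id _
  ; src      = inject₁
  ; tgt      = suc
  ; loopless = λ _ → inject₁≢suc
  ; simple   = λ { (inj₁ (p , _)) → inject₁-injective p
                 ; (inj₂ (p , q)) → ⊥-elim (no-swap p q) }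
  }

-- The cycle on n ≥ 3 vertices: the edges {i , i+1} of the path on 0,…,n-1
-- (edge suc i), together with the closing edge {0 , n-1} (edge zero).
C : (n : ℕ) → {True (3 ≤? n)} → Graph
C (suc (suc (suc k))) = record
  { V        = Fin (3 + k)
  ; E        = Fin (3 + k)
  ; order    = 3 + k
  ; size     = 3 + k
  ; V↔Fin    = ↔-id _
  ; E↔Fin    = ↔-id _
  ; src      = s
  ; tgt      = t
  ; loopless = λ { zero () ; (suc _) → inject₁≢suc }
  ; simple   = λ {e} {e′} → simp e e′
  }
  where
  s t : Fin (3 + k) → Fin (3 + k)
  s zero    = zero
  s (suc i) = inject₁ i
  t zero    = fromℕ (2 + k)
  t (suc i) = suc i
  simp : ∀ e e′ → (s e ≡ s e′ × t e ≡ t e′) ⊎ (s e ≡ t e′ × t e ≡ s e′) → e ≡ e′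
  simp zero    zero          _              = refl
  simp zero    (suc zero)    (inj₁ (_ , ()))
  simp zero    (suc (suc j)) (inj₁ (() , _))
  simp zero    (suc j)       (inj₂ (() , _))
  simp (suc zero)    zero    (inj₁ (_ , ()))
  simp (suc (suc i)) zero    (inj₁ (() , _))
  simp (suc i) zero          (inj₂ (_ , ()))
  simp (suc i) (suc j)       (inj₁ (_ , q)) = q
  simp (suc i) (suc j)       (inj₂ (p , q)) = ⊥-elim (no-swap p q)

-- Every graph here has χₗₜ = 2n + 2a + 1.  Let M = 12m + 9n + 3a and
-- N = p + q = M + 2n + 2a.
--
-- Lower bound: the weight of a leaf is the label of its edge, so the 2n + 2a
-- leaves have distinct weights ≤ N, and whatever carries the label N forces a
-- weight > N on some neighbour.
--
-- Upper bound: walking through a component, vertices and edges alternate, and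
-- the weight of each is the sum of the labels of its two neighbours.  Give the
-- pendant edges the labels M + 1, …, N.  Every other label ≤ M is "low" (rank r,
-- label 1 + r) or "high" (rank y, label M − y); a low and a high neighbour then
-- produce the weight M + 1 + (r − y), which is a pendant label as soon as
-- 0 ≤ r − y < 2n + 2a.  A pendant edge of a P₆ adds up with a suitably low
-- second edge to a label ≤ N.  Only the centre of a P₃ lies between two pendant
-- edges; the sum of their labels is kept constant, which is the one weight > N.
module Submission where

open import Defs
open import Data.Fin using (Fin; zero; suc; toℕ; fromℕ; opposite)
open import Data.Fin.Patterns
open import Data.Fin.Permutation using (reverse; cast-id)
open import Data.Fin.Properties
  using ( toℕ-injective; injective⇒≤; ≤fromℕ; toℕ<n; toℕ-cast; toℕ-↑ˡ; toℕ-↑ʳ; toℕ-combine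
        ; opposite-prop; opposite-involutive; +↔⊎; *↔×)
open import Data.List using (List; _∷_; map; filter; length; lookup; tabulate; upTo; _++_)
open import Data.List.Membership.Propositional using (_∈_)
open import Data.List.Membership.Propositional.Properties
  using ( ∈-lookup; ∈-map⁺; ∈-map⁻; ∈-++⁺ˡ; ∈-++⁺ʳ; ∈-++⁻; ∈-filter⁺; ∈-filter⁻; ∈-allFin
        ; ∈-tabulate⁻; ∈-upTo⁺; ∈-deduplicate⁺; ∈-deduplicate⁻)
open import Data.List.Membership.Propositional.Properties.WithK using (unique∧set⇒bag)
import Data.List.Membership.Setoid.Properties as SetoidMembership
open import Data.List.Properties using (length-map; length-upTo; length-tabulate; map-∘; map-cong)
open import Data.List.Relation.Binary.BagAndSetEquality using (∼bag⇒↭)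
open import Data.List.Relation.Binary.Permutation.Propositional using (_↭_)
open import Data.List.Relation.Binary.Permutation.Propositional.Properties using (map⁺)
open import Data.List.Relation.Binary.Subset.Propositional using (_⊆_)
import Data.List.Relation.Unary.All as All
import Data.List.Relation.Unary.All.Properties as All
open import Data.List.Relation.Unary.AllPairs using (_∷_)
open import Data.List.Relation.Unary.Any using (here; there; index)
open import Data.List.Relation.Unary.Unique.Propositional using (Unique)
import Data.List.Relation.Unary.Unique.Propositional.Properties as Unique
open import Data.List.Relation.Unary.Unique.DecPropositional.Properties using (deduplicate-!)
open import Data.Nat using (ℕ; suc; _+_; _*_; _∸_; _≤_; _<_; _≟_; z≤n; s≤s; >-nonZero)
open import Data.Nat.ListAction using (sum)
open import Data.Nat.ListAction.Properties using (sum-↭)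
open import Data.Nat.Properties
  using ( suc-injective; +-comm; +-suc; +-identityʳ; +-cancelˡ-≡; +-cancelʳ-≡; *-comm; *-suc; *-identityʳ
        ; ≤-refl; ≤-trans; ≤-antisym; <-trans; ≤-<-trans; <-≤-trans; <⇒≢; >⇒≢; m≤m+n; m≤n+m; m<m+n; m<n+m
        ; +-mono-≤; +-monoˡ-≤; +-monoʳ-≤; +-monoˡ-<; +-monoʳ-<; +-mono-<-≤; *-monoʳ-≤; *-monoʳ-<; m∸n+n≡m)
open import Data.Nat.Tactic.RingSolver using (solve-∀)
open import Data.Product using (_×_; _,_; proj₁; proj₂; ∃; ∃-syntax)
open import Data.Sum as Sum using (_⊎_; inj₁; inj₂)
open import Data.Sum.Function.Propositional using (_⊎-↔_)
open import Data.Sum.Properties using (inj₁-injective; inj₂-injective)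
open import Function.Base using (_∘_)
open import Function.Bundles using (_↔_; Injection; Inverse; Bijection; mk⇔; mk↔ₛ′)
open import Function.Construct.Identity using (↔-id)
open import Function.Definitions using (Injective)
open import Function.Properties.Inverse using (↔-sym; ↔-trans; ↔⇒↣; ↔⇒⤖)
open import Relation.Binary.PropositionalEquality
  using (_≡_; _≢_; refl; sym; trans; cong; cong₂; subst; subst₂; setoid; module ≡-Reasoning)
open import Relation.Nullary using (¬_; contradiction)

-- Lengths of duplicate-free lists.

module _ {A : Set} where

  lookup-injective : ∀ {xs : List A} → Unique xs → ∀ {i j} → lookup xs i ≡ lookup xs j → i ≡ j
  lookup-injective (_  ∷ _) {zero}  {zero}  _  = refl
  lookup-injective (x≢ ∷ _) {zero}  {suc j} eq = contradiction eq (All.lookup x≢ (∈-lookup j))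
  lookup-injective (x≢ ∷ _) {suc i} {zero}  eq = contradiction (sym eq) (All.lookup x≢ (∈-lookup i))
  lookup-injective (_  ∷ u) {suc i} {suc j} eq = cong suc (lookup-injective u eq)

  -- Pigeonhole: sending a position in `xs` to a position of the same entry in `ys` is injective,
  -- because equal positions in `ys` force equal entries of `xs`.
  length-⊆ : ∀ {xs ys : List A} → Unique xs → xs ⊆ ys → length xs ≤ length ys
  length-⊆ u xs⊆ys = injective⇒≤ {f = λ i → index (xs⊆ys (∈-lookup i))} λ {i} {j} eq →
    lookup-injective u
      (SetoidMembership.index-injective (setoid A) (xs⊆ys (∈-lookup i)) (xs⊆ys (∈-lookup j)) eq)

-- Weights and their restriction to components.

module _ (G : Graph) where
  open Graph G

  -- Takes any function as labels, since the labels seen by a single component of a larger graph do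
  -- not form a bijection onto an initial segment.
  weightOf : (V ⊎ E → ℕ) → V ⊎ E → ℕ
  weightOf ℓ (inj₁ u) = sum (map (ℓ ∘ inj₂) (filter (incident? u) edges))
  weightOf ℓ (inj₂ e) = ℓ (inj₁ (src e)) + ℓ (inj₁ (tgt e))

  weight≗weightOf : ∀ f x → weight G f x ≡ weightOf (label G f) x
  weight≗weightOf f (inj₁ _) = refl
  weight≗weightOf f (inj₂ _) = refl

  star : V → List E
  star u = filter (incident? u) edges

  ∈-edges : ∀ e → e ∈ edges
  ∈-edges e = subst (_∈ edges) (Inverse.strictlyInverseʳ E↔Fin e)
    (∈-map⁺ (Inverse.from E↔Fin) (∈-allFin (Inverse.to E↔Fin e)))

  star-unique : ∀ u → Unique (star u)
  star-unique u = Unique.filter⁺ (incident? u)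
    (Unique.map⁺ (Injection.injective (↔⇒↣ (↔-sym E↔Fin))) (Unique.allFin⁺ size))

  label-injective : ∀ f {x y} → label G f x ≡ label G f y → x ≡ y
  label-injective f eq = Bijection.injective f (toℕ-injective (suc-injective eq))

-- The field `closed` is what makes weights restrict: no edge of `H` outside the image contributes
-- to the weight of a vertex in the image.
record Component (G H : Graph) : Set where
  private
    module G = Graph G
    module H = Graph H
  field
    ιV           : G.V → H.V
    ιE           : G.E → H.E
    ιE-injective : Injective _≡_ _≡_ ιE
    ι-src        : ∀ e → H.src (ιE e) ≡ ιV (G.src e)
    ι-tgt        : ∀ e → H.tgt (ιE e) ≡ ιV (G.tgt e)
    closed       : ∀ {u e′} → H.Incident (ιV u) e′ → ∃[ e ] (e′ ≡ ιE e × G.Incident u e)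

  ι : G.V ⊎ G.E → H.V ⊎ H.E
  ι = Sum.map ιV ιE

  ι-incident : ∀ {u e} → G.Incident u e → H.Incident (ιV u) (ιE e)
  ι-incident {e = e} (inj₁ refl) = inj₁ (sym (ι-src e))
  ι-incident {e = e} (inj₂ refl) = inj₂ (sym (ι-tgt e))

  -- Both lists are duplicate-free with the same elements. A permutation suffices because the stars
  -- are only summed over.
  ι-star : ∀ u → star H (ιV u) ↭ map ιE (star G u)
  ι-star u = ∼bag⇒↭ (unique∧set⇒bag (star-unique H (ιV u)) (Unique.map⁺ ιE-injective (star-unique G u))
    (mk⇔ to from))
    where
    to : ∀ {e′} → e′ ∈ star H (ιV u) → e′ ∈ map ιE (star G u)
    to e′∈ with closed (proj₂ (∈-filter⁻ (H.incident? (ιV u)) {xs = H.edges} e′∈))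
    ... | e , refl , u∼e = ∈-map⁺ ιE (∈-filter⁺ (G.incident? u) (∈-edges G e) u∼e)
    from : ∀ {e′} → e′ ∈ map ιE (star G u) → e′ ∈ star H (ιV u)
    from e′∈ with ∈-map⁻ ιE e′∈
    ... | e , e∈ , refl = ∈-filter⁺ (H.incident? (ιV u)) (∈-edges H (ιE e))
      (ι-incident (proj₂ (∈-filter⁻ (G.incident? u) {xs = G.edges} e∈)))

  weightOf-ι : ∀ ℓ x → weightOf H ℓ (ι x) ≡ weightOf G (ℓ ∘ ι) x
  weightOf-ι ℓ (inj₁ u) = trans (sum-↭ (map⁺ (ℓ ∘ inj₂) (ι-star u))) (cong sum (sym (map-∘ (star G u))))
  weightOf-ι ℓ (inj₂ e) = cong₂ (λ u v → ℓ (inj₁ u) + ℓ (inj₁ v)) (ι-src e) (ι-tgt e)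

  -- Moves every weight computation into a concrete `C 6`, `P 6` or `P 3`, where the stars evaluate
  -- to explicit lists.
  weight-ι : ∀ f x → weight H f (ι x) ≡ weightOf G (label H f ∘ ι) x
  weight-ι f x = trans (weight≗weightOf H f (ι x)) (weightOf-ι (label H f) x)

_∘ᶜ_ : ∀ {G H K} → Component H K → Component G H → Component G K
c ∘ᶜ d = record
  { ιV           = C.ιV ∘ D.ιV
  ; ιE           = C.ιE ∘ D.ιE
  ; ιE-injective = D.ιE-injective ∘ C.ιE-injective
  ; ι-src        = λ e → trans (C.ι-src (D.ιE e)) (cong C.ιV (D.ι-src e))
  ; ι-tgt        = λ e → trans (C.ι-tgt (D.ιE e)) (cong C.ιV (D.ι-tgt e))
  ; closed       = λ u∼e → let e′ , p , u∼e′ = C.closed u∼e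
                               e , q , u∼e″ = D.closed u∼e′
                           in e , trans p (cong C.ιE q) , u∼e″
  }
  where
  module C = Component c
  module D = Component d

⊕ˡ : ∀ {G H} → Component G (G ⊕ H)
⊕ˡ = record
  { ιV           = inj₁
  ; ιE           = inj₁
  ; ιE-injective = inj₁-injective
  ; ι-src        = λ _ → refl
  ; ι-tgt        = λ _ → refl
  ; closed       = λ { {e′ = inj₁ e} u∼e → e , refl , Sum.map inj₁-injective inj₁-injective u∼e
                     ; {e′ = inj₂ _} (inj₁ ())
                     ; {e′ = inj₂ _} (inj₂ ()) }
  }

⊕ʳ : ∀ {G H} → Component H (G ⊕ H)
⊕ʳ = record
  { ιV           = inj₂
  ; ιE           = inj₂
  ; ιE-injective = inj₂-injective
  ; ι-src        = λ _ → refl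
  ; ι-tgt        = λ _ → refl
  ; closed       = λ { {e′ = inj₂ e} u∼e → e , refl , Sum.map inj₂-injective inj₂-injective u∼e
                     ; {e′ = inj₁ _} (inj₁ ())
                     ; {e′ = inj₁ _} (inj₂ ()) }
  }

copy : ∀ {m G} → Fin m → Component G (m · G)
copy i = record
  { ιV           = i ,_
  ; ιE           = i ,_
  ; ιE-injective = cong proj₂
  ; ι-src        = λ _ → refl
  ; ι-tgt        = λ _ → refl
  ; closed       = λ { {e′ = _ , e} (inj₁ refl) → e , refl , inj₁ refl
                     ; {e′ = _ , e} (inj₂ refl) → e , refl , inj₂ refl }
  }

-- Local conditions and the number of distinct weights.

module _ (G : Graph) (f : TotalLabeling G) where
  open Graph G
  private
    ℓ = label G f
    w = weight G f

  -- Edges sharing an end never collide: cancelling the label of the common end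
  -- leaves two distinct vertex labels.
  isLocalTotalAntimagic :
    (∀ e → w (inj₁ (src e)) ≢ w (inj₁ (tgt e))) →
    (∀ e → w (inj₁ (src e)) ≢ w (inj₂ e)) →
    (∀ e → w (inj₁ (tgt e)) ≢ w (inj₂ e)) →
    IsLocalTotalAntimagic G f
  isLocalTotalAntimagic src≢tgt src≢e tgt≢e = record
    { vertex-vertex = vertex-vertex
    ; edge-edge     = λ { (e≢e′ , _ , u∼e , u∼e′) eq → e≢e′ (edge-edge u∼e u∼e′ eq) }
    ; vertex-edge   = λ { {e = e} (inj₁ refl) → src≢e e ; {e = e} (inj₂ refl) → tgt≢e e }
    }
    where
    vertex-vertex : ∀ {u v} → AdjacentV u v → w (inj₁ u) ≢ w (inj₁ v)
    vertex-vertex (u≢v , e , inj₁ refl , inj₁ refl) = contradiction refl u≢v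
    vertex-vertex (u≢v , e , inj₁ refl , inj₂ refl) = src≢tgt e
    vertex-vertex (u≢v , e , inj₂ refl , inj₁ refl) = src≢tgt e ∘ sym
    vertex-vertex (u≢v , e , inj₂ refl , inj₂ refl) = contradiction refl u≢v

    ends : ∀ {u u′ v v′} → u ≡ u′ → ℓ (inj₁ u) + ℓ (inj₁ v) ≡ ℓ (inj₁ u′) + ℓ (inj₁ v′) → v ≡ v′
    ends {u} refl eq = inj₁-injective (label-injective G f (+-cancelˡ-≡ (ℓ (inj₁ u)) _ _ eq))

    flip+ : ∀ e → w (inj₂ e) ≡ ℓ (inj₁ (tgt e)) + ℓ (inj₁ (src e))
    flip+ e = +-comm (ℓ (inj₁ (src e))) _

    edge-edge : ∀ {u e e′} → Incident u e → Incident u e′ → w (inj₂ e) ≡ w (inj₂ e′) → e ≡ e′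
    edge-edge {e = e} {e′} (inj₁ refl) (inj₁ p) eq = simple (inj₁ (p , ends p eq))
    edge-edge {e = e} {e′} (inj₁ refl) (inj₂ p) eq = simple (inj₂ (p , ends p (trans eq (flip+ e′))))
    edge-edge {e = e} {e′} (inj₂ refl) (inj₁ p) eq = simple (inj₂ (ends p (trans (sym (flip+ e)) eq) , p))
    edge-edge {e = e} {e′} (inj₂ refl) (inj₂ p) eq =
      simple (inj₁ (ends p (trans (sym (flip+ e)) (trans eq (flip+ e′))) , p))

  private
    ws = map (w ∘ inj₁) vertices ++ map (w ∘ inj₂) edges

    w∈ws : ∀ x → w x ∈ ws
    w∈ws (inj₁ u) = ∈-++⁺ˡ (∈-map⁺ (w ∘ inj₁)
      (subst (_∈ vertices) (Inverse.strictlyInverseʳ V↔Fin u)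
        (∈-map⁺ (Inverse.from V↔Fin) (∈-allFin (Inverse.to V↔Fin u)))))
    w∈ws (inj₂ e) = ∈-++⁺ʳ (map (w ∘ inj₁) vertices) (∈-map⁺ (w ∘ inj₂) (∈-edges G e))

    ws-elim : ∀ {P : ℕ → Set} → (∀ x → P (w x)) → ∀ {k} → k ∈ ws → P k
    ws-elim Pw k∈ with ∈-++⁻ (map (w ∘ inj₁) vertices) k∈
    ... | inj₁ k∈V with ∈-map⁻ (w ∘ inj₁) k∈V
    ...   | u , _ , refl = Pw (inj₁ u)
    ws-elim Pw k∈ | inj₂ k∈E with ∈-map⁻ (w ∘ inj₂) k∈E
    ...   | e , _ , refl = Pw (inj₂ e)

  length≤weightCount : ∀ {ks} → Unique ks → (∀ {k} → k ∈ ks → ∃[ x ] k ≡ w x) → length ks ≤ weightCount G f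
  length≤weightCount u attained = length-⊆ u λ k∈ → let x , eq = attained k∈ in
    ∈-deduplicate⁺ _≟_ (subst (_∈ ws) (sym eq) (w∈ws x))

  weightCount≤length : ∀ {ks} → (∀ x → w x ∈ ks) → weightCount G f ≤ length ks
  weightCount≤length {ks} w∈ = length-⊆ (deduplicate-! _≟_ ws) λ k∈ →
    ws-elim {P = _∈ ks} w∈ (∈-deduplicate⁻ _≟_ ws k∈)

  -- Surjectivity gives a preimage of the last index. The element `x₀` ensures that there is a last
  -- index.
  maximum-label : V ⊎ E → ∃[ x ] ∀ y → ℓ y ≤ ℓ x
  maximum-label x₀ =
    let i , max = maxFin (Bijection.to f x₀)
        x , to[x]≡i = Bijection.surjective f i
    in x , λ y → s≤s (subst (toℕ (Bijection.to f y) ≤_) (cong toℕ (sym (to[x]≡i refl))) (max _))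
    where
    maxFin : ∀ {k} → Fin k → ∃ λ (i : Fin k) → ∀ (j : Fin k) → toℕ j ≤ toℕ i
    maxFin {suc k} _ = fromℕ k , ≤fromℕ

  -- The pendant labels are `k` distinct weights, none above the largest label; `exceeded`, applied
  -- to the carrier of that label, supplies one more weight lying strictly above it.
  leaves<weightCount : ∀ {k} (leaf : Fin k → V) (pendant : Fin k → E) →
    Injective _≡_ _≡_ pendant → (∀ i → w (inj₁ (leaf i)) ≡ ℓ (inj₂ (pendant i))) →
    V ⊎ E → (∀ x → ∃[ y ] ℓ x < w y) → k < weightCount G f
  leaves<weightCount {k} leaf pendant pendant-injective w-leaf x₀ exceeded =
    subst (λ l → suc l ≤ weightCount G f) (length-tabulate ℓs)
      (length≤weightCount (All.tabulate⁺ big≢ ∷ Unique.tabulate⁺ ℓs-injective) attained)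
    where
    ℓs : Fin k → ℕ
    ℓs = ℓ ∘ inj₂ ∘ pendant
    ℓs-injective : ∀ {i j} → ℓs i ≡ ℓs j → i ≡ j
    ℓs-injective = pendant-injective ∘ inj₂-injective ∘ label-injective G f
    top = maximum-label x₀
    big = exceeded (proj₁ top)
    big≢ : ∀ i → w (proj₁ big) ≢ ℓs i
    big≢ i = >⇒≢ (≤-<-trans (proj₂ top _) (proj₂ big))
    attained : ∀ {l} → l ∈ w (proj₁ big) ∷ tabulate ℓs → ∃[ x ] l ≡ w x
    attained (here refl) = proj₁ big , refl
    attained (there l∈)  with ∈-tabulate⁻ l∈
    ... | i , refl = inj₁ (leaf i) , sym (w-leaf i)

weightOf-cong : ∀ G {ℓ ℓ′} → (∀ x → ℓ x ≡ ℓ′ x) → ∀ x → weightOf G ℓ x ≡ weightOf G ℓ′ x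
weightOf-cong G ℓ≗ℓ′ (inj₁ u) = cong sum (map-cong (ℓ≗ℓ′ ∘ inj₂) (star G u))
weightOf-cong G ℓ≗ℓ′ (inj₂ e) = cong₂ _+_ (ℓ≗ℓ′ _) (ℓ≗ℓ′ _)

infixr 6 _⊎ᶠ_

_⊎ᶠ_ : ∀ {A B : Set} {k l} → A ↔ Fin k → B ↔ Fin l → (A ⊎ B) ↔ Fin (k + l)
R ⊎ᶠ S = ↔-trans (R ⊎-↔ S) (↔-sym +↔⊎)

×ᶠ : ∀ {k l} → (Fin k × Fin l) ↔ Fin (k * l)
×ᶠ = ↔-sym *↔×

-- Additive, without truncated subtraction, so that it combines with semiring identities.
toℕ-opposite : ∀ {k} (i : Fin k) → toℕ (opposite i) + suc (toℕ i) ≡ k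
toℕ-opposite i = trans (cong (_+ suc (toℕ i)) (opposite-prop i)) (m∸n+n≡m (toℕ<n i))

toℕ-opposite′ : ∀ {k} (i : Fin k) → toℕ i + suc (toℕ (opposite i)) ≡ k
toℕ-opposite′ i = trans (trans (+-suc _ _) (+-comm (suc (toℕ i)) _)) (toℕ-opposite i)

-- Names for the elements of the union and for the label slots.

pattern vC6 c v = inj₁ (inj₁ (c , v))
pattern vP6 j v = inj₁ (inj₂ (inj₁ (j , v)))
pattern vP3 i v = inj₁ (inj₂ (inj₂ (i , v)))
pattern eC6 c e = inj₂ (inj₁ (c , e))
pattern eP6 j e = inj₂ (inj₂ (inj₁ (j , e)))
pattern eP3 i e = inj₂ (inj₂ (inj₂ (i , e)))

pattern loP6  k j = inj₁ (inj₁ (k , j))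
pattern loP3  k i = inj₁ (inj₂ (inj₁ (k , i)))
pattern loC6  c k = inj₁ (inj₂ (inj₂ (c , k)))
pattern hiP6  k j = inj₂ (inj₁ (inj₁ (k , j)))
pattern hiP3  i   = inj₂ (inj₁ (inj₂ (inj₁ i)))
pattern hiC6  c k = inj₂ (inj₁ (inj₂ (inj₂ (c , k))))
pattern topP3 k i = inj₂ (inj₂ (inj₁ (k , i)))
pattern topP6 k j = inj₂ (inj₂ (inj₂ (k , j)))

-- Every label is exceeded by some weight.

Exceeded : ∀ G → (Graph.V G ⊎ Graph.E G → ℕ) → Graph.V G ⊎ Graph.E G → Set
Exceeded G ℓ x = ∃[ y ] ℓ x < weightOf G ℓ y

private
  -- The `+ 0` is the empty tail when `sum` runs over the two edges at a vertex of degree two.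
  x<x+y+0 : ∀ x {y} → 0 < y → x < x + (y + 0)
  x<x+y+0 x 0<y = m<m+n x (≤-trans 0<y (m≤m+n _ 0))

  y<x+y+0 : ∀ y {x} → 0 < x → y < x + (y + 0)
  y<x+y+0 y {x} 0<x = subst (λ z → y < x + z) (sym (+-identityʳ y)) (m<n+m y 0<x)

-- A vertex label is a proper summand of the weight of an incident edge. An edge label is one of the
-- weight of an end of degree two; each edge of a hexagon, and likewise of `P 6` and `P 3`, has such
-- an end.
exceeded-C6 : ∀ ℓ → (∀ x → 0 < ℓ x) → ∀ x → Exceeded (C 6) ℓ x
exceeded-C6 ℓ 0<ℓ (inj₁ 0F)      = inj₂ 0F , m<m+n _ (0<ℓ _)
exceeded-C6 ℓ 0<ℓ (inj₁ (suc i)) = inj₂ (suc i) , m<n+m _ (0<ℓ _)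
exceeded-C6 ℓ 0<ℓ (inj₂ 0F)      = inj₁ 0F , x<x+y+0 (ℓ (inj₂ 0F)) (0<ℓ (inj₂ 1F))
exceeded-C6 ℓ 0<ℓ (inj₂ 1F)      = inj₁ 0F , y<x+y+0 (ℓ (inj₂ 1F)) (0<ℓ (inj₂ 0F))
exceeded-C6 ℓ 0<ℓ (inj₂ 2F)      = inj₁ 1F , y<x+y+0 (ℓ (inj₂ 2F)) (0<ℓ (inj₂ 1F))
exceeded-C6 ℓ 0<ℓ (inj₂ 3F)      = inj₁ 2F , y<x+y+0 (ℓ (inj₂ 3F)) (0<ℓ (inj₂ 2F))
exceeded-C6 ℓ 0<ℓ (inj₂ 4F)      = inj₁ 3F , y<x+y+0 (ℓ (inj₂ 4F)) (0<ℓ (inj₂ 3F))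
exceeded-C6 ℓ 0<ℓ (inj₂ 5F)      = inj₁ 4F , y<x+y+0 (ℓ (inj₂ 5F)) (0<ℓ (inj₂ 4F))

exceeded-P6 : ∀ ℓ → (∀ x → 0 < ℓ x) → ∀ x → Exceeded (P 6) ℓ x
exceeded-P6 ℓ 0<ℓ (inj₁ 0F)      = inj₂ 0F , m<m+n _ (0<ℓ _)
exceeded-P6 ℓ 0<ℓ (inj₁ (suc i)) = inj₂ i , m<n+m _ (0<ℓ _)
exceeded-P6 ℓ 0<ℓ (inj₂ 0F)      = inj₁ 1F , x<x+y+0 (ℓ (inj₂ 0F)) (0<ℓ (inj₂ 1F))
exceeded-P6 ℓ 0<ℓ (inj₂ 1F)      = inj₁ 1F , y<x+y+0 (ℓ (inj₂ 1F)) (0<ℓ (inj₂ 0F))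
exceeded-P6 ℓ 0<ℓ (inj₂ 2F)      = inj₁ 2F , y<x+y+0 (ℓ (inj₂ 2F)) (0<ℓ (inj₂ 1F))
exceeded-P6 ℓ 0<ℓ (inj₂ 3F)      = inj₁ 3F , y<x+y+0 (ℓ (inj₂ 3F)) (0<ℓ (inj₂ 2F))
exceeded-P6 ℓ 0<ℓ (inj₂ 4F)      = inj₁ 4F , y<x+y+0 (ℓ (inj₂ 4F)) (0<ℓ (inj₂ 3F))

exceeded-P3 : ∀ ℓ → (∀ x → 0 < ℓ x) → ∀ x → Exceeded (P 3) ℓ x
exceeded-P3 ℓ 0<ℓ (inj₁ 0F)      = inj₂ 0F , m<m+n _ (0<ℓ _)
exceeded-P3 ℓ 0<ℓ (inj₁ (suc i)) = inj₂ i , m<n+m _ (0<ℓ _)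
exceeded-P3 ℓ 0<ℓ (inj₂ 0F)      = inj₁ 1F , x<x+y+0 (ℓ (inj₂ 0F)) (0<ℓ (inj₂ 1F))
exceeded-P3 ℓ 0<ℓ (inj₂ 1F)      = inj₁ 1F , y<x+y+0 (ℓ (inj₂ 1F)) (0<ℓ (inj₂ 0F))

-- The labeling that attains the bound.

module Construction (m n a : ℕ) where

  G : Graph
  G = m · C 6 ⊕ n · P 6 ⊕ a · P 3
  open Graph G

  hexagon : Fin m → Component (C 6) G
  hexagon c = ⊕ˡ ∘ᶜ copy c

  long : Fin n → Component (P 6) G
  long j = ⊕ʳ ∘ᶜ (⊕ˡ ∘ᶜ copy j)

  short : Fin a → Component (P 3) G
  short i = ⊕ʳ ∘ᶜ (⊕ʳ ∘ᶜ copy i)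

  -- Low labels ascend, high labels descend from M, and the labels of the pendant
  -- edges descend from N.
  Lo Hi Top Slot : Set
  Lo   = (Fin 5 × Fin n) ⊎ (Fin 2 × Fin a) ⊎ (Fin m × Fin 6)
  Hi   = (Fin 4 × Fin n) ⊎ Fin a ⊎ (Fin m × Fin 6)
  Top  = (Fin 2 × Fin a) ⊎ (Fin 2 × Fin n)
  Slot = Lo ⊎ Hi ⊎ Top

  ∣Lo∣ ∣Hi∣ ∣Top∣ M N : ℕ
  ∣Lo∣  = 5 * n + (2 * a + m * 6)
  ∣Hi∣  = 4 * n + (a + m * 6)
  ∣Top∣ = 2 * a + 2 * n
  M     = ∣Lo∣ + ∣Hi∣
  N     = M + ∣Top∣

  Lo↔ : Lo ↔ Fin ∣Lo∣
  Lo↔ = ×ᶠ ⊎ᶠ ×ᶠ ⊎ᶠ ×ᶠ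

  Hi↔ : Hi ↔ Fin ∣Hi∣
  Hi↔ = ×ᶠ ⊎ᶠ ↔-id _ ⊎ᶠ ×ᶠ

  Top↔ : Top ↔ Fin ∣Top∣
  Top↔ = ×ᶠ ⊎ᶠ ×ᶠ

  Slot↔ : Slot ↔ Fin (∣Lo∣ + (∣Hi∣ + ∣Top∣))
  Slot↔ = Lo↔ ⊎ᶠ ↔-trans Hi↔ reverse ⊎ᶠ ↔-trans Top↔ reverse

  -- Chosen so that, along the alternation of edges and vertices, the weights
  -- exceed M + 1 periodically by n + a − 1, n + a + 1, n + a in a C₆, and by
  -- 0, 2n, n inside a P₆.
  place : V ⊎ E → Slot
  place (vC6 c 0F) = loC6 c 1F
  place (vC6 c 1F) = hiC6 c 2F
  place (vC6 c 2F) = loC6 c 2F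
  place (vC6 c 3F) = hiC6 c 1F
  place (vC6 c 4F) = loC6 c 0F
  place (vC6 c 5F) = hiC6 c 0F
  place (eC6 c 0F) = hiC6 c 5F
  place (eC6 c 1F) = loC6 c 5F
  place (eC6 c 2F) = hiC6 c 4F
  place (eC6 c 3F) = loC6 c 3F
  place (eC6 c 4F) = hiC6 c 3F
  place (eC6 c 5F) = loC6 c 4F
  place (vP6 j 0F) = loP6 3F j
  place (vP6 j 1F) = hiP6 3F j
  place (vP6 j 2F) = loP6 4F j
  place (vP6 j 3F) = hiP6 2F j
  place (vP6 j 4F) = loP6 2F j
  place (vP6 j 5F) = hiP6 1F j
  place (eP6 j 0F) = topP6 0F j
  place (eP6 j 1F) = loP6 0F j
  place (eP6 j 2F) = hiP6 0F j
  place (eP6 j 3F) = loP6 1F j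
  place (eP6 j 4F) = topP6 1F j
  place (vP3 i 0F) = loP3 0F i
  place (vP3 i 1F) = hiP3 i
  place (vP3 i 2F) = loP3 1F i
  place (eP3 i 0F) = topP3 1F (opposite i)
  place (eP3 i 1F) = topP3 0F i

  unplace : Slot → V ⊎ E
  unplace (loC6 c 0F)  = vC6 c 4F
  unplace (loC6 c 1F)  = vC6 c 0F
  unplace (loC6 c 2F)  = vC6 c 2F
  unplace (loC6 c 3F)  = eC6 c 3F
  unplace (loC6 c 4F)  = eC6 c 5F
  unplace (loC6 c 5F)  = eC6 c 1F
  unplace (hiC6 c 0F)  = vC6 c 5F
  unplace (hiC6 c 1F)  = vC6 c 3F
  unplace (hiC6 c 2F)  = vC6 c 1F
  unplace (hiC6 c 3F)  = eC6 c 4F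
  unplace (hiC6 c 4F)  = eC6 c 2F
  unplace (hiC6 c 5F)  = eC6 c 0F
  unplace (loP6 0F j)  = eP6 j 1F
  unplace (loP6 1F j)  = eP6 j 3F
  unplace (loP6 2F j)  = vP6 j 4F
  unplace (loP6 3F j)  = vP6 j 0F
  unplace (loP6 4F j)  = vP6 j 2F
  unplace (hiP6 0F j)  = eP6 j 2F
  unplace (hiP6 1F j)  = vP6 j 5F
  unplace (hiP6 2F j)  = vP6 j 3F
  unplace (hiP6 3F j)  = vP6 j 1F
  unplace (topP6 0F j) = eP6 j 0F
  unplace (topP6 1F j) = eP6 j 4F
  unplace (loP3 0F i)  = vP3 i 0F
  unplace (loP3 1F i)  = vP3 i 2F
  unplace (hiP3 i)     = vP3 i 1F
  unplace (topP3 0F i) = eP3 i 1F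
  unplace (topP3 1F i) = eP3 (opposite i) 0F

  unplace-place : ∀ x → unplace (place x) ≡ x
  unplace-place (vC6 c 0F) = refl
  unplace-place (vC6 c 1F) = refl
  unplace-place (vC6 c 2F) = refl
  unplace-place (vC6 c 3F) = refl
  unplace-place (vC6 c 4F) = refl
  unplace-place (vC6 c 5F) = refl
  unplace-place (eC6 c 0F) = refl
  unplace-place (eC6 c 1F) = refl
  unplace-place (eC6 c 2F) = refl
  unplace-place (eC6 c 3F) = refl
  unplace-place (eC6 c 4F) = refl
  unplace-place (eC6 c 5F) = refl
  unplace-place (vP6 j 0F) = refl
  unplace-place (vP6 j 1F) = refl
  unplace-place (vP6 j 2F) = refl
  unplace-place (vP6 j 3F) = refl
  unplace-place (vP6 j 4F) = refl
  unplace-place (vP6 j 5F) = refl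
  unplace-place (eP6 j 0F) = refl
  unplace-place (eP6 j 1F) = refl
  unplace-place (eP6 j 2F) = refl
  unplace-place (eP6 j 3F) = refl
  unplace-place (eP6 j 4F) = refl
  unplace-place (vP3 i 0F) = refl
  unplace-place (vP3 i 1F) = refl
  unplace-place (vP3 i 2F) = refl
  unplace-place (eP3 i 0F) = cong (λ i′ → eP3 i′ 0F) (opposite-involutive i)
  unplace-place (eP3 i 1F) = refl

  place-unplace : ∀ s → place (unplace s) ≡ s
  place-unplace (loC6 c 0F)  = refl
  place-unplace (loC6 c 1F)  = refl
  place-unplace (loC6 c 2F)  = refl
  place-unplace (loC6 c 3F)  = refl
  place-unplace (loC6 c 4F)  = refl
  place-unplace (loC6 c 5F)  = refl
  place-unplace (hiC6 c 0F)  = refl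
  place-unplace (hiC6 c 1F)  = refl
  place-unplace (hiC6 c 2F)  = refl
  place-unplace (hiC6 c 3F)  = refl
  place-unplace (hiC6 c 4F)  = refl
  place-unplace (hiC6 c 5F)  = refl
  place-unplace (loP6 0F j)  = refl
  place-unplace (loP6 1F j)  = refl
  place-unplace (loP6 2F j)  = refl
  place-unplace (loP6 3F j)  = refl
  place-unplace (loP6 4F j)  = refl
  place-unplace (hiP6 0F j)  = refl
  place-unplace (hiP6 1F j)  = refl
  place-unplace (hiP6 2F j)  = refl
  place-unplace (hiP6 3F j)  = refl
  place-unplace (topP6 0F j) = refl
  place-unplace (topP6 1F j) = refl
  place-unplace (loP3 0F i)  = refl
  place-unplace (loP3 1F i)  = refl
  place-unplace (hiP3 i)     = refl
  place-unplace (topP3 0F i) = refl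
  place-unplace (topP3 1F i) = cong (λ i′ → topP3 1F i′) (opposite-involutive i)

  labels≡order+size : ∣Lo∣ + (∣Hi∣ + ∣Top∣) ≡ order + size
  labels≡order+size = eq m n a
    where
    eq : ∀ m n a → (5 * n + (2 * a + m * 6)) + ((4 * n + (a + m * 6)) + (2 * a + 2 * n))
                 ≡ (m * 6 + (n * 6 + a * 3)) + (m * 6 + (n * 5 + a * 2))
    eq = solve-∀

  f : TotalLabeling G
  f = ↔⇒⤖ (↔-trans (↔-trans (mk↔ₛ′ place unplace place-unplace unplace-place) Slot↔)
                   (cast-id labels≡order+size))

  -- For the paths, one role in the component fills a block of consecutive ranks as the copy varies;
  -- for the hexagons, one copy fills six consecutive ranks. Hence path excesses are governed by
  -- block offsets, and hexagon excesses by positions within a copy.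
  rankLo : Lo → ℕ
  rankLo (inj₁ (k , j))        = n * toℕ k + toℕ j
  rankLo (inj₂ (inj₁ (k , i))) = 5 * n + (a * toℕ k + toℕ i)
  rankLo (inj₂ (inj₂ (c , k))) = 5 * n + (2 * a + (6 * toℕ c + toℕ k))

  rankHi : Hi → ℕ
  rankHi (inj₁ (k , j))        = n * toℕ k + toℕ j
  rankHi (inj₂ (inj₁ i))       = 4 * n + toℕ i
  rankHi (inj₂ (inj₂ (c , k))) = 4 * n + (a + (6 * toℕ c + toℕ k))

  rankTop : Top → ℕ
  rankTop (inj₁ (k , i)) = a * toℕ k + toℕ i
  rankTop (inj₂ (k , j)) = 2 * a + (n * toℕ k + toℕ j)

  toℕ-Lo↔ : ∀ r → toℕ (Inverse.to Lo↔ r) ≡ rankLo r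
  toℕ-Lo↔ (inj₁ (k , j))        = trans (toℕ-↑ˡ _ _) (toℕ-combine k j)
  toℕ-Lo↔ (inj₂ (inj₁ (k , i))) =
    trans (toℕ-↑ʳ (5 * n) _) (cong (5 * n +_) (trans (toℕ-↑ˡ _ _) (toℕ-combine k i)))
  toℕ-Lo↔ (inj₂ (inj₂ (c , k))) =
    trans (toℕ-↑ʳ (5 * n) _) (cong (5 * n +_)
      (trans (toℕ-↑ʳ (2 * a) _) (cong (2 * a +_) (toℕ-combine c k))))

  toℕ-Hi↔ : ∀ y → toℕ (Inverse.to Hi↔ y) ≡ rankHi y
  toℕ-Hi↔ (inj₁ (k , j))        = trans (toℕ-↑ˡ _ _) (toℕ-combine k j)
  toℕ-Hi↔ (inj₂ (inj₁ i))       = trans (toℕ-↑ʳ (4 * n) _) (cong (4 * n +_) (toℕ-↑ˡ _ _))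
  toℕ-Hi↔ (inj₂ (inj₂ (c , k))) =
    trans (toℕ-↑ʳ (4 * n) _) (cong (4 * n +_)
      (trans (toℕ-↑ʳ a _) (cong (a +_) (toℕ-combine c k))))

  toℕ-Top↔ : ∀ z → toℕ (Inverse.to Top↔ z) ≡ rankTop z
  toℕ-Top↔ (inj₁ (k , i)) = trans (toℕ-↑ˡ _ _) (toℕ-combine k i)
  toℕ-Top↔ (inj₂ (k , j)) = trans (toℕ-↑ʳ (2 * a) _) (cong (2 * a +_) (toℕ-combine k j))

  -- Kept opaque so that slots can be inferred from their values by unification.
  opaque
    value : Slot → ℕ
    value s = suc (toℕ (Inverse.to Slot↔ s))

    label≗value : ∀ x → label G f x ≡ value (place x)
    label≗value x = cong suc (toℕ-cast labels≡order+size (Inverse.to Slot↔ (place x)))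

    value-Lo : ∀ r → value (inj₁ r) ≡ suc (rankLo r)
    value-Lo r = cong suc (trans (toℕ-↑ˡ _ _) (toℕ-Lo↔ r))

    -- `reverse` sends rank `y` to one less than the block size minus `y`; the shift of labels to
    -- start at 1 absorbs that one.
    value-Hi : ∀ y → value (inj₂ (inj₁ y)) + rankHi y ≡ M
    value-Hi y = begin
      value (inj₂ (inj₁ y)) + rankHi y
        ≡⟨ cong₂ (λ v r → suc v + r)
             (trans (toℕ-↑ʳ ∣Lo∣ _) (cong (∣Lo∣ +_) (toℕ-↑ˡ (opposite (Inverse.to Hi↔ y)) _))) (sym (toℕ-Hi↔ y)) ⟩
      suc (∣Lo∣ + toℕ (opposite (Inverse.to Hi↔ y))) + toℕ (Inverse.to Hi↔ y)
        ≡⟨ assoc ∣Lo∣ _ _ ⟩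
      ∣Lo∣ + (toℕ (opposite (Inverse.to Hi↔ y)) + suc (toℕ (Inverse.to Hi↔ y)))
        ≡⟨ cong (∣Lo∣ +_) (toℕ-opposite (Inverse.to Hi↔ y)) ⟩
      M ∎
      where
      open ≡-Reasoning
      assoc : ∀ l o t → suc (l + o) + t ≡ l + (o + suc t)
      assoc = solve-∀

    value-Top : ∀ z → value (inj₂ (inj₂ z)) + rankTop z ≡ N
    value-Top z = begin
      value (inj₂ (inj₂ z)) + rankTop z
        ≡⟨ cong₂ (λ v r → suc v + r)
             (trans (toℕ-↑ʳ ∣Lo∣ _) (cong (∣Lo∣ +_) (toℕ-↑ʳ ∣Hi∣ (opposite (Inverse.to Top↔ z))))) (sym (toℕ-Top↔ z)) ⟩
      suc (∣Lo∣ + (∣Hi∣ + toℕ (opposite (Inverse.to Top↔ z)))) + toℕ (Inverse.to Top↔ z)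
        ≡⟨ assoc ∣Lo∣ ∣Hi∣ _ _ ⟩
      M + (toℕ (opposite (Inverse.to Top↔ z)) + suc (toℕ (Inverse.to Top↔ z)))
        ≡⟨ cong (M +_) (toℕ-opposite (Inverse.to Top↔ z)) ⟩
      N ∎
      where
      open ≡-Reasoning
      assoc : ∀ l h o t → suc (l + (h + o)) + t ≡ l + h + (o + suc t)
      assoc = solve-∀

  -- Only the difference of the ranks survives. For two neighbours in one component the copy index
  -- cancels in it, so all copies share the weight.
  sum-Lo-Hi : ∀ s r y → rankLo r ≡ s + rankHi y → value (inj₁ r) + value (inj₂ (inj₁ y)) ≡ M + suc s
  sum-Lo-Hi s r y r≡s+y = begin
    value (inj₁ r) + value (inj₂ (inj₁ y))      ≡⟨ cong (_+ value (inj₂ (inj₁ y))) (trans (value-Lo r) (cong suc r≡s+y)) ⟩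
    suc (s + rankHi y) + value (inj₂ (inj₁ y))  ≡⟨ swap s _ _ ⟩
    (value (inj₂ (inj₁ y)) + rankHi y) + suc s  ≡⟨ cong (_+ suc s) (value-Hi y) ⟩
    M + suc s                                   ∎
    where
    open ≡-Reasoning
    swap : ∀ s y v → suc (s + y) + v ≡ (v + y) + suc s
    swap = solve-∀

  sum-Hi-Lo : ∀ s y r → rankLo r ≡ s + rankHi y → value (inj₂ (inj₁ y)) + value (inj₁ r) ≡ M + suc s
  sum-Hi-Lo s y r eq = trans (+-comm (value (inj₂ (inj₁ y))) _) (sum-Lo-Hi s r y eq)

  -- Here `s` is the rank counted from the bottom of the pendant labels, which puts leaf weights in
  -- the same form as the other weights.
  value-Top′ : ∀ s z → s + suc (rankTop z) ≡ ∣Top∣ → value (inj₂ (inj₂ z)) ≡ M + suc s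
  value-Top′ s z eq = +-cancelʳ-≡ (rankTop z) _ _ (begin
    value (inj₂ (inj₂ z)) + rankTop z  ≡⟨ value-Top z ⟩
    M + ∣Top∣                          ≡⟨ cong (M +_) eq ⟨
    M + (s + suc (rankTop z))          ≡⟨ assoc M s _ ⟩
    M + suc s + rankTop z              ∎)
    where
    open ≡-Reasoning
    assoc : ∀ M s z → M + (s + suc z) ≡ M + suc s + z
    assoc = solve-∀

  -- With `r` the low rank, the labels are N - 2a - r and 1 + r, so r cancels. The 2a top ranks
  -- before those of the P₆ are taken by the P₃, which keeps the sum within N.
  sum-Top-Lo : ∀ z r → rankTop z ≡ 2 * a + rankLo r → value (inj₂ (inj₂ z)) + value (inj₁ r) ≡ M + suc (n * 2)
  sum-Top-Lo z r z≡ = +-cancelʳ-≡ (2 * a) _ _ (begin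
    value (inj₂ (inj₂ z)) + value (inj₁ r) + 2 * a     ≡⟨ cong (λ v → value (inj₂ (inj₂ z)) + v + 2 * a) (value-Lo r) ⟩
    value (inj₂ (inj₂ z)) + suc (rankLo r) + 2 * a     ≡⟨ swap (value (inj₂ (inj₂ z))) (rankLo r) (2 * a) ⟩
    suc (value (inj₂ (inj₂ z)) + (2 * a + rankLo r))   ≡⟨ cong (λ t → suc (value (inj₂ (inj₂ z)) + t)) z≡ ⟨
    suc (value (inj₂ (inj₂ z)) + rankTop z)            ≡⟨ cong suc (value-Top z) ⟩
    suc (M + ∣Top∣)                                    ≡⟨ arrange M n a ⟩
    M + suc (n * 2) + 2 * a                            ∎)
    where
    open ≡-Reasoning
    swap : ∀ v r b → v + suc r + b ≡ suc (v + (b + r))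
    swap = solve-∀
    arrange : ∀ M n a → suc (M + (2 * a + 2 * n)) ≡ M + suc (n * 2) + 2 * a
    arrange = solve-∀

  -- Thanks to `opposite`, one pendant label rises as the other falls, so the sum does not depend on
  -- `i`.
  sum-Top-Top : ∀ i → value (topP3 1F (opposite i)) + value (topP3 0F i) ≡ M + suc (N + n * 2)
  -- The cancelled term is the sum of the two ranks plus one, which equals 2a.
  sum-Top-Top i = +-cancelʳ-≡ (a + (i′ + suc (toℕ i))) _ _ (begin
    v′ + v + (a + (i′ + suc (toℕ i)))                    ≡⟨ swap v v′ a (toℕ i) i′ ⟩
    suc ((v′ + (a * 1 + i′)) + (v + (a * 0 + toℕ i)))    ≡⟨ cong₂ (λ x y → suc (x + y)) (value-Top _) (value-Top _) ⟩
    suc (N + N)                                          ≡⟨ arrange M N n a ⟩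
    M + suc (N + n * 2) + (a + a)                        ≡⟨ cong (λ t → M + suc (N + n * 2) + (a + t)) (toℕ-opposite i) ⟨
    M + suc (N + n * 2) + (a + (i′ + suc (toℕ i)))       ∎)
    where
    open ≡-Reasoning
    i′ = toℕ (opposite i)
    v = value (topP3 0F i)
    v′ = value (topP3 1F (opposite i))
    swap : ∀ v v′ a i i′ → v′ + v + (a + (i′ + suc i)) ≡ suc ((v′ + (a * 1 + i′)) + (v + (a * 0 + i)))
    swap = solve-∀
    arrange : ∀ M N n a → suc (N + (M + (2 * a + 2 * n))) ≡ M + suc (N + n * 2) + (a + a)
    arrange = solve-∀

  -- The weights of the labeling.

  module Weights (q : ℕ) (q+1≡n+a : suc q ≡ n + a) where

    -- The weight minus M + 1.
    excess : V ⊎ E → ℕ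
    excess (vC6 c 0F) = 1 + q
    excess (vC6 c 1F) = 2 + q
    excess (vC6 c 2F) = q
    excess (vC6 c 3F) = 1 + q
    excess (vC6 c 4F) = 2 + q
    excess (vC6 c 5F) = q
    excess (eC6 c 0F) = 2 + q
    excess (eC6 c 1F) = q
    excess (eC6 c 2F) = 1 + q
    excess (eC6 c 3F) = 2 + q
    excess (eC6 c 4F) = q
    excess (eC6 c 5F) = 1 + q
    excess (vP6 j 0F) = n * 1 + toℕ (opposite j)
    excess (vP6 j 1F) = n * 2
    excess (vP6 j 2F) = n * 0
    excess (vP6 j 3F) = n * 1
    excess (vP6 j 4F) = n * 2
    excess (vP6 j 5F) = n * 0 + toℕ (opposite j)
    excess (eP6 j 0F) = n * 0
    excess (eP6 j 1F) = n * 1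
    excess (eP6 j 2F) = n * 2
    excess (eP6 j 3F) = n * 0
    excess (eP6 j 4F) = n * 1
    excess (vP3 i 0F) = n * 2 + (a * 0 + toℕ i)
    excess (vP3 i 1F) = N + n * 2
    excess (vP3 i 2F) = n * 2 + (a * 1 + toℕ (opposite i))
    excess (eP3 i 0F) = n + a * 0
    excess (eP3 i 1F) = n + a * 1

    rank-P6 : ∀ l d (j : Fin n) → n * (d + l) + toℕ j ≡ n * d + (n * l + toℕ j)
    rank-P6 l d j = eq n l d (toℕ j)
      where
      eq : ∀ n l d j → n * (d + l) + j ≡ n * d + (n * l + j)
      eq = solve-∀

    -- The offset `n` arises because five low P₆ blocks precede the P₃ ranks, against four high
    -- ones.
    rank-P3 : ∀ k (i : Fin a) → 5 * n + (a * k + toℕ i) ≡ (n + a * k) + (4 * n + toℕ i)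
    rank-P3 k i = eq n a k (toℕ i)
      where
      eq : ∀ n a k i → 5 * n + (a * k + i) ≡ (n + a * k) + (4 * n + i)
      eq = solve-∀

    -- The ranks differ by n + a + k - l, that is, q + 1 + k - l. Neighbours in a hexagon have k - l
    -- among -1, 0, 1, so `t` is 0, 1 or 2.
    rank-C6 : ∀ (c : Fin m) k l t → suc k ≡ l + t →
      5 * n + (2 * a + (6 * toℕ c + k)) ≡ (t + q) + (4 * n + (a + (6 * toℕ c + l)))
    rank-C6 c k l t k+1≡l+t = suc-injective (begin
      suc (5 * n + (2 * a + (6 * toℕ c + k)))          ≡⟨ push n a (toℕ c) k ⟩
      5 * n + (2 * a + (6 * toℕ c + suc k))            ≡⟨ cong (λ x → 5 * n + (2 * a + (6 * toℕ c + x))) k+1≡l+t ⟩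
      5 * n + (2 * a + (6 * toℕ c + (l + t)))          ≡⟨ split n a (toℕ c) l t ⟩
      t + (n + a) + (4 * n + (a + (6 * toℕ c + l)))    ≡⟨ cong (λ x → t + x + (4 * n + (a + (6 * toℕ c + l)))) q+1≡n+a ⟨
      t + suc q + (4 * n + (a + (6 * toℕ c + l)))      ≡⟨ cong (_+ (4 * n + (a + (6 * toℕ c + l)))) (+-suc t q) ⟩
      suc (t + q) + (4 * n + (a + (6 * toℕ c + l)))    ∎)
      where
      open ≡-Reasoning
      push : ∀ n a c k → suc (5 * n + (2 * a + (6 * c + k))) ≡ 5 * n + (2 * a + (6 * c + suc k))
      push = solve-∀
      split : ∀ n a c l t → 5 * n + (2 * a + (6 * c + (l + t))) ≡ t + (n + a) + (4 * n + (a + (6 * c + l)))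
      split = solve-∀

    -- Top labels descend: block `k` of the two P₆ blocks from above is block `k′` from below, and
    -- position `j` becomes `opposite j`.
    leaf-P6 : ∀ k k′ (j : Fin n) → k + k′ ≡ 1 →
      n * k′ + toℕ (opposite j) + suc (2 * a + (n * k + toℕ j)) ≡ ∣Top∣
    leaf-P6 k k′ j k+k′≡1 = begin
      n * k′ + j′ + suc (2 * a + (n * k + toℕ j))      ≡⟨ arrange n a k k′ (toℕ j) j′ ⟩
      2 * a + (n * (k + k′) + (j′ + suc (toℕ j)))      ≡⟨ cong₂ (λ x y → 2 * a + (n * x + y)) k+k′≡1 (toℕ-opposite j) ⟩
      2 * a + (n * 1 + n)                              ≡⟨ double n a ⟩
      2 * a + 2 * n                                    ∎
      where
      open ≡-Reasoning
      j′ = toℕ (opposite j)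
      arrange : ∀ n a k k′ j j′ → n * k′ + j′ + suc (2 * a + (n * k + j)) ≡ 2 * a + (n * (k + k′) + (j′ + suc j))
      arrange = solve-∀
      double : ∀ n a → 2 * a + (n * 1 + n) ≡ 2 * a + 2 * n
      double = solve-∀

    -- The mirrored positions `p` and `p′` are kept general because one pendant edge already sits at
    -- `opposite i`, and reversing brings it back to `i`.
    leaf-P3 : ∀ k k′ p p′ → k + k′ ≡ 1 → p + suc p′ ≡ a →
      n * 2 + (a * k′ + p) + suc (a * k + p′) ≡ ∣Top∣
    leaf-P3 k k′ p p′ k+k′≡1 p+p′+1≡a = begin
      n * 2 + (a * k′ + p) + suc (a * k + p′)          ≡⟨ arrange n a k k′ p p′ ⟩
      n * 2 + (a * (k + k′) + (p + suc p′))            ≡⟨ cong₂ (λ x y → n * 2 + (a * x + y)) k+k′≡1 p+p′+1≡a ⟩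
      n * 2 + (a * 1 + a)                              ≡⟨ double n a ⟩
      2 * a + 2 * n                                    ∎
      where
      open ≡-Reasoning
      arrange : ∀ n a k k′ p p′ → n * 2 + (a * k′ + p) + suc (a * k + p′) ≡ n * 2 + (a * (k + k′) + (p + suc p′))
      arrange = solve-∀
      double : ∀ n a → n * 2 + (a * 1 + a) ≡ 2 * a + 2 * n
      double = solve-∀

    private
      at-vertex : ∀ p q {s} → value p + value q ≡ s → value p + (value q + 0) ≡ s
      at-vertex p q = trans (cong (value p +_) (+-identityʳ (value q)))

      in-component : ∀ {H} (κ : Component H G) x →
        weight G f (Component.ι κ x) ≡ weightOf H (value ∘ place ∘ Component.ι κ) x
      in-component {H} κ x = trans (Component.weight-ι κ f x)
        (weightOf-cong H (label≗value ∘ Component.ι κ) x)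

    weight-C6 : ∀ c x → weightOf (C 6) (value ∘ place ∘ Component.ι (hexagon c)) x
                        ≡ M + suc (excess (Component.ι (hexagon c) x))
    weight-C6 c (inj₁ 0F) = at-vertex (hiC6 c 5F) (loC6 c 5F) (sum-Hi-Lo _ _ _ (rank-C6 c 5 5 1 refl))
    weight-C6 c (inj₁ 1F) = at-vertex (loC6 c 5F) (hiC6 c 4F) (sum-Lo-Hi _ _ _ (rank-C6 c 5 4 2 refl))
    weight-C6 c (inj₁ 2F) = at-vertex (hiC6 c 4F) (loC6 c 3F) (sum-Hi-Lo _ _ _ (rank-C6 c 3 4 0 refl))
    weight-C6 c (inj₁ 3F) = at-vertex (loC6 c 3F) (hiC6 c 3F) (sum-Lo-Hi _ _ _ (rank-C6 c 3 3 1 refl))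
    weight-C6 c (inj₁ 4F) = at-vertex (hiC6 c 3F) (loC6 c 4F) (sum-Hi-Lo _ _ _ (rank-C6 c 4 3 2 refl))
    weight-C6 c (inj₁ 5F) = at-vertex (hiC6 c 5F) (loC6 c 4F) (sum-Hi-Lo _ _ _ (rank-C6 c 4 5 0 refl))
    weight-C6 c (inj₂ 0F) = sum-Lo-Hi _ _ _ (rank-C6 c 1 0 2 refl)
    weight-C6 c (inj₂ 1F) = sum-Lo-Hi _ _ _ (rank-C6 c 1 2 0 refl)
    weight-C6 c (inj₂ 2F) = sum-Hi-Lo _ _ _ (rank-C6 c 2 2 1 refl)
    weight-C6 c (inj₂ 3F) = sum-Lo-Hi _ _ _ (rank-C6 c 2 1 2 refl)
    weight-C6 c (inj₂ 4F) = sum-Hi-Lo _ _ _ (rank-C6 c 0 1 0 refl)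
    weight-C6 c (inj₂ 5F) = sum-Lo-Hi _ _ _ (rank-C6 c 0 0 1 refl)

    weight-P6 : ∀ j x → weightOf (P 6) (value ∘ place ∘ Component.ι (long j)) x
                        ≡ M + suc (excess (Component.ι (long j) x))
    weight-P6 j (inj₁ 0F) = trans (+-identityʳ _) (value-Top′ _ _ (leaf-P6 0 1 j refl))
    weight-P6 j (inj₁ 1F) = at-vertex (topP6 0F j) (loP6 0F j) (sum-Top-Lo _ _ refl)
    weight-P6 j (inj₁ 2F) = at-vertex (loP6 0F j) (hiP6 0F j) (sum-Lo-Hi _ _ _ (rank-P6 0 0 j))
    weight-P6 j (inj₁ 3F) = at-vertex (hiP6 0F j) (loP6 1F j) (sum-Hi-Lo _ _ _ (rank-P6 0 1 j))
    weight-P6 j (inj₁ 4F) = at-vertex (loP6 1F j) (topP6 1F j) (trans (+-comm (value (loP6 1F j)) _) (sum-Top-Lo _ _ refl))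
    weight-P6 j (inj₁ 5F) = trans (+-identityʳ _) (value-Top′ _ _ (leaf-P6 1 0 j refl))
    weight-P6 j (inj₂ 0F) = sum-Lo-Hi _ _ _ (rank-P6 3 0 j)
    weight-P6 j (inj₂ 1F) = sum-Hi-Lo _ _ _ (rank-P6 3 1 j)
    weight-P6 j (inj₂ 2F) = sum-Lo-Hi _ _ _ (rank-P6 2 2 j)
    weight-P6 j (inj₂ 3F) = sum-Hi-Lo _ _ _ (rank-P6 2 0 j)
    weight-P6 j (inj₂ 4F) = sum-Lo-Hi _ _ _ (rank-P6 1 1 j)

    weight-P3 : ∀ i x → weightOf (P 3) (value ∘ place ∘ Component.ι (short i)) x
                        ≡ M + suc (excess (Component.ι (short i) x))
    weight-P3 i (inj₁ 0F) = trans (+-identityʳ _) (value-Top′ _ _ (leaf-P3 1 0 _ _ refl (toℕ-opposite′ i)))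
    weight-P3 i (inj₁ 1F) = at-vertex (topP3 1F (opposite i)) (topP3 0F i) (sum-Top-Top i)
    weight-P3 i (inj₁ 2F) = trans (+-identityʳ _) (value-Top′ _ _ (leaf-P3 0 1 _ _ refl (toℕ-opposite i)))
    weight-P3 i (inj₂ 0F) = sum-Lo-Hi _ _ _ (rank-P3 0 i)
    weight-P3 i (inj₂ 1F) = sum-Hi-Lo _ _ _ (rank-P3 1 i)

    weight-excess : ∀ x → weight G f x ≡ M + suc (excess x)
    weight-excess (vC6 c v) = trans (in-component (hexagon c) (inj₁ v)) (weight-C6 c (inj₁ v))
    weight-excess (vP6 j v) = trans (in-component (long j) (inj₁ v)) (weight-P6 j (inj₁ v))
    weight-excess (vP3 i v) = trans (in-component (short i) (inj₁ v)) (weight-P3 i (inj₁ v))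
    weight-excess (eC6 c e) = trans (in-component (hexagon c) (inj₂ e)) (weight-C6 c (inj₂ e))
    weight-excess (eP6 j e) = trans (in-component (long j) (inj₂ e)) (weight-P6 j (inj₂ e))
    weight-excess (eP3 i e) = trans (in-component (short i) (inj₂ e)) (weight-P3 i (inj₂ e))

    -- Distinctness and range of the excesses.

    module _ (0<n : 0 < n) (0<a : 0 < a) where

      n*-mono-< : ∀ {k l} → k < l → n * k < n * l
      n*-mono-< = *-monoʳ-< n {{>-nonZero 0<n}}

      n<n*2 : n < n * 2
      n<n*2 = subst (_< n * 2) (*-identityʳ n) (n*-mono-< {1} (s≤s (s≤s z≤n)))

      n*k+j<n*[1+k] : ∀ k (j : Fin n) → n * k + toℕ j < n * suc k
      n*k+j<n*[1+k] k j = subst (n * k + toℕ j <_) (trans (+-comm (n * k) n) (sym (*-suc n k)))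
        (+-monoʳ-< (n * k) (toℕ<n j))

      -- Separates a P₃ leaf from its pendant edge: both excesses contain the same multiple `a * k`,
      -- which leaves n against at least 2n.
      n+a*k<n*2+a*k+p : ∀ k p → n + a * k < n * 2 + (a * k + p)
      n+a*k<n*2+a*k+p k p = +-mono-<-≤ n<n*2 (m≤m+n (a * k) p)

      [s+1]+r⇒s< : ∀ s {r} → s + suc r ≡ ∣Top∣ → s < ∣Top∣
      [s+1]+r⇒s< s eq = subst (s <_) eq (m<m+n s (s≤s z≤n))

      n*k<∣Top∣ : ∀ {k} → k ≤ 2 → n * k < ∣Top∣
      n*k<∣Top∣ {k} k≤2 = ≤-<-trans (*-monoʳ-≤ n k≤2)
        (subst (_< ∣Top∣) (*-comm 2 n) (m<n+m (2 * n) (≤-trans 0<a (m≤m+n a _))))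

      n+a*k<∣Top∣ : ∀ {k} → k ≤ 1 → n + a * k < ∣Top∣
      n+a*k<∣Top∣ {k} k≤1 = ≤-<-trans (+-monoʳ-≤ n (*-monoʳ-≤ a k≤1))
        (subst (n + a * 1 <_) (eq n a) (m<m+n (n + a * 1) (≤-trans 0<n (m≤m+n n a))))
        where
        eq : ∀ n a → n + a * 1 + (n + a) ≡ 2 * a + 2 * n
        eq = solve-∀

      t+q<∣Top∣ : ∀ {t} → t ≤ 2 → t + q < ∣Top∣
      t+q<∣Top∣ {t} t≤2 = ≤-<-trans (+-monoˡ-≤ q t≤2)
        -- The extreme value 2 + q is n + a + 1, which is below 2(n + a) because n + a is at least
        -- 2.
        (subst₂ _<_ (cong suc (sym q+1≡n+a)) (eq n a) (+-monoˡ-< (n + a) (+-mono-≤ 0<n 0<a)))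
        where
        eq : ∀ n a → n + a + (n + a) ≡ 2 * a + 2 * n
        eq = solve-∀

      -- The first alternative means that the weight is a pendant label; the second occurs at the P₃
      -- centres, which all share one weight.
      excess-range : ∀ x → excess x < ∣Top∣ ⊎ excess x ≡ N + n * 2
      excess-range (vC6 c 0F) = inj₁ (t+q<∣Top∣ {1} (s≤s z≤n))
      excess-range (vC6 c 1F) = inj₁ (t+q<∣Top∣ {2} ≤-refl)
      excess-range (vC6 c 2F) = inj₁ (t+q<∣Top∣ {0} z≤n)
      excess-range (vC6 c 3F) = inj₁ (t+q<∣Top∣ {1} (s≤s z≤n))
      excess-range (vC6 c 4F) = inj₁ (t+q<∣Top∣ {2} ≤-refl)
      excess-range (vC6 c 5F) = inj₁ (t+q<∣Top∣ {0} z≤n)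
      excess-range (eC6 c 0F) = inj₁ (t+q<∣Top∣ {2} ≤-refl)
      excess-range (eC6 c 1F) = inj₁ (t+q<∣Top∣ {0} z≤n)
      excess-range (eC6 c 2F) = inj₁ (t+q<∣Top∣ {1} (s≤s z≤n))
      excess-range (eC6 c 3F) = inj₁ (t+q<∣Top∣ {2} ≤-refl)
      excess-range (eC6 c 4F) = inj₁ (t+q<∣Top∣ {0} z≤n)
      excess-range (eC6 c 5F) = inj₁ (t+q<∣Top∣ {1} (s≤s z≤n))
      excess-range (vP6 j 0F) = inj₁ ([s+1]+r⇒s< _ (leaf-P6 0 1 j refl))
      excess-range (vP6 j 1F) = inj₁ (n*k<∣Top∣ ≤-refl)
      excess-range (vP6 j 2F) = inj₁ (n*k<∣Top∣ z≤n)
      excess-range (vP6 j 3F) = inj₁ (n*k<∣Top∣ (s≤s z≤n))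
      excess-range (vP6 j 4F) = inj₁ (n*k<∣Top∣ ≤-refl)
      excess-range (vP6 j 5F) = inj₁ ([s+1]+r⇒s< _ (leaf-P6 1 0 j refl))
      excess-range (eP6 j 0F) = inj₁ (n*k<∣Top∣ z≤n)
      excess-range (eP6 j 1F) = inj₁ (n*k<∣Top∣ (s≤s z≤n))
      excess-range (eP6 j 2F) = inj₁ (n*k<∣Top∣ ≤-refl)
      excess-range (eP6 j 3F) = inj₁ (n*k<∣Top∣ z≤n)
      excess-range (eP6 j 4F) = inj₁ (n*k<∣Top∣ (s≤s z≤n))
      excess-range (vP3 i 0F) = inj₁ ([s+1]+r⇒s< _ (leaf-P3 1 0 _ _ refl (toℕ-opposite′ i)))
      excess-range (vP3 i 1F) = inj₂ refl
      excess-range (vP3 i 2F) = inj₁ ([s+1]+r⇒s< _ (leaf-P3 0 1 _ _ refl (toℕ-opposite i)))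
      excess-range (eP3 i 0F) = inj₁ (n+a*k<∣Top∣ z≤n)
      excess-range (eP3 i 1F) = inj₁ (n+a*k<∣Top∣ ≤-refl)

      <∣Top∣⇒<N+n*2 : ∀ {s} → s < ∣Top∣ → s < N + n * 2
      <∣Top∣⇒<N+n*2 s< = <-≤-trans s< (≤-trans (m≤n+m ∣Top∣ M) (m≤m+n N (n * 2)))

      private
        0<1 : 0 < 1
        0<1 = s≤s z≤n
        1<2 : 1 < 2
        1<2 = s≤s 0<1
        0<2 : 0 < 2
        0<2 = s≤s z≤n

      -- In a hexagon the values are `q`, `1 + q`, `2 + q`, so the absurd patterns suffice. Inside a
      -- P₆ three consecutive excesses are 0, n, 2n in some order. Its leaf next to 0 and 2n lies in
      -- [n, 2n), and the one next to n and 2n lies in [0, n).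
      excess-distinct : ∀ e → excess (inj₁ (src e)) ≢ excess (inj₁ (tgt e))
                            × excess (inj₁ (src e)) ≢ excess (inj₂ e)
                            × excess (inj₁ (tgt e)) ≢ excess (inj₂ e)
      excess-distinct (inj₁ (c , 0F)) = (λ ()) , (λ ()) , (λ ())
      excess-distinct (inj₁ (c , 1F)) = (λ ()) , (λ ()) , (λ ())
      excess-distinct (inj₁ (c , 2F)) = (λ ()) , (λ ()) , (λ ())
      excess-distinct (inj₁ (c , 3F)) = (λ ()) , (λ ()) , (λ ())
      excess-distinct (inj₁ (c , 4F)) = (λ ()) , (λ ()) , (λ ())
      excess-distinct (inj₁ (c , 5F)) = (λ ()) , (λ ()) , (λ ())
      excess-distinct (inj₂ (inj₁ (j , 0F))) =
        <⇒≢ (n*k+j<n*[1+k] 1 (opposite j)) , >⇒≢ (<-≤-trans (n*-mono-< 0<1) (m≤m+n _ _)) , >⇒≢ (n*-mono-< 0<2)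
      excess-distinct (inj₂ (inj₁ (j , 1F))) =
        >⇒≢ (n*-mono-< 0<2) , >⇒≢ (n*-mono-< 1<2) , <⇒≢ (n*-mono-< 0<1)
      excess-distinct (inj₂ (inj₁ (j , 2F))) =
        <⇒≢ (n*-mono-< 0<1) , <⇒≢ (n*-mono-< 0<2) , <⇒≢ (n*-mono-< 1<2)
      excess-distinct (inj₂ (inj₁ (j , 3F))) =
        <⇒≢ (n*-mono-< 1<2) , >⇒≢ (n*-mono-< 0<1) , >⇒≢ (n*-mono-< 0<2)
      excess-distinct (inj₂ (inj₁ (j , 4F))) =
        >⇒≢ (<-trans (n*k+j<n*[1+k] 0 (opposite j)) (n*-mono-< 1<2)) , >⇒≢ (n*-mono-< 1<2) ,
        <⇒≢ (n*k+j<n*[1+k] 0 (opposite j))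
      excess-distinct (inj₂ (inj₂ (i , 0F))) =
        <⇒≢ (<∣Top∣⇒<N+n*2 ([s+1]+r⇒s< _ (leaf-P3 1 0 _ _ refl (toℕ-opposite′ i)))) ,
        >⇒≢ (n+a*k<n*2+a*k+p 0 (toℕ i)) ,
        >⇒≢ (<∣Top∣⇒<N+n*2 (n+a*k<∣Top∣ {0} z≤n))
      excess-distinct (inj₂ (inj₂ (i , 1F))) =
        >⇒≢ (<∣Top∣⇒<N+n*2 ([s+1]+r⇒s< _ (leaf-P3 0 1 _ _ refl (toℕ-opposite i)))) ,
        >⇒≢ (<∣Top∣⇒<N+n*2 (n+a*k<∣Top∣ {1} ≤-refl)) ,
        >⇒≢ (n+a*k<n*2+a*k+p 1 (toℕ (opposite i)))

      weight-≢ : ∀ {x y} → excess x ≢ excess y → weight G f x ≢ weight G f y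
      weight-≢ {x} {y} x≢y eq = x≢y (suc-injective (+-cancelˡ-≡ M _ _
        (trans (sym (weight-excess x)) (trans eq (weight-excess y)))))

      f-isLocalTotalAntimagic : IsLocalTotalAntimagic G f
      f-isLocalTotalAntimagic = isLocalTotalAntimagic G f
        (λ e → weight-≢ {inj₁ (src e)} {inj₁ (tgt e)} (proj₁ (excess-distinct e)))
        (λ e → weight-≢ {inj₁ (src e)} {inj₂ e} (proj₁ (proj₂ (excess-distinct e))))
        (λ e → weight-≢ {inj₁ (tgt e)} {inj₂ e} (proj₂ (proj₂ (excess-distinct e))))

      weightCount-f≤ : weightCount G f ≤ suc ∣Top∣
      weightCount-f≤ = subst (λ l → weightCount G f ≤ suc l)
        (trans (length-map (λ s → M + suc s) (upTo ∣Top∣)) (length-upTo ∣Top∣))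
        (weightCount≤length G f λ x → subst (_∈ ks) (sym (weight-excess x)) (∈ks (excess-range x)))
        where
        ks = M + suc (N + n * 2) ∷ map (λ s → M + suc s) (upTo ∣Top∣)
        ∈ks : ∀ {s} → s < ∣Top∣ ⊎ s ≡ N + n * 2 → M + suc s ∈ ks
        ∈ks (inj₁ s<)   = there (∈-map⁺ (λ s → M + suc s) (∈-upTo⁺ s<))
        ∈ks (inj₂ refl) = here refl

  -- The lower bound for the union.

  leaf : Top → V
  leaf (inj₁ (0F , i)) = inj₂ (inj₂ (i , 2F))
  leaf (inj₁ (1F , i)) = inj₂ (inj₂ (opposite i , 0F))
  leaf (inj₂ (0F , j)) = inj₂ (inj₁ (j , 0F))
  leaf (inj₂ (1F , j)) = inj₂ (inj₁ (j , 5F))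

  pendant : Top → E
  pendant (inj₁ (0F , i)) = inj₂ (inj₂ (i , 1F))
  pendant (inj₁ (1F , i)) = inj₂ (inj₂ (opposite i , 0F))
  pendant (inj₂ (0F , j)) = inj₂ (inj₁ (j , 0F))
  pendant (inj₂ (1F , j)) = inj₂ (inj₁ (j , 4F))

  -- `pendant` is `unplace` on the top slots, so `place` undoes it and its injectivity follows.
  place-pendant : ∀ z → place (inj₂ (pendant z)) ≡ inj₂ (inj₂ z)
  place-pendant z@(inj₁ (0F , _)) = place-unplace (inj₂ (inj₂ z))
  place-pendant z@(inj₁ (1F , _)) = place-unplace (inj₂ (inj₂ z))
  place-pendant z@(inj₂ (0F , _)) = place-unplace (inj₂ (inj₂ z))
  place-pendant z@(inj₂ (1F , _)) = place-unplace (inj₂ (inj₂ z))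

  pendant-injective : Injective _≡_ _≡_ pendant
  pendant-injective {z} {z′} eq = inj₂-injective (inj₂-injective
    (trans (sym (place-pendant z)) (trans (cong (place ∘ inj₂) eq) (place-pendant z′))))

  weight-leaf : ∀ g z → weight G g (inj₁ (leaf z)) ≡ label G g (inj₂ (pendant z))
  weight-leaf g (inj₁ (0F , i)) = trans (Component.weight-ι (short i) g (inj₁ 2F)) (+-identityʳ _)
  weight-leaf g (inj₁ (1F , i)) = trans (Component.weight-ι (short (opposite i)) g (inj₁ 0F)) (+-identityʳ _)
  weight-leaf g (inj₂ (0F , j)) = trans (Component.weight-ι (long j) g (inj₁ 0F)) (+-identityʳ _)
  weight-leaf g (inj₂ (1F , j)) = trans (Component.weight-ι (long j) g (inj₁ 5F)) (+-identityʳ _)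

  exceeded : ∀ g x → ∃[ y ] label G g x < weight G g y
  exceeded g = λ
    { (vC6 c v) → via (hexagon c) (inj₁ v) (exceeded-C6 _ (λ _ → s≤s z≤n) (inj₁ v))
    ; (vP6 j v) → via (long j)    (inj₁ v) (exceeded-P6 _ (λ _ → s≤s z≤n) (inj₁ v))
    ; (vP3 i v) → via (short i)   (inj₁ v) (exceeded-P3 _ (λ _ → s≤s z≤n) (inj₁ v))
    ; (eC6 c e) → via (hexagon c) (inj₂ e) (exceeded-C6 _ (λ _ → s≤s z≤n) (inj₂ e))
    ; (eP6 j e) → via (long j)    (inj₂ e) (exceeded-P6 _ (λ _ → s≤s z≤n) (inj₂ e))
    ; (eP3 i e) → via (short i)   (inj₂ e) (exceeded-P3 _ (λ _ → s≤s z≤n) (inj₂ e))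
    }
    where
    via : ∀ {H} (κ : Component H G) x → Exceeded H (label G g ∘ Component.ι κ) x →
          ∃[ y ] label G g (Component.ι κ x) < weight G g y
    via κ x (y , ℓ<w) = Component.ι κ y , subst (label G g (Component.ι κ x) <_) (sym (Component.weight-ι κ g y)) ℓ<w

  ∣Top∣<weightCount : V ⊎ E → ∀ g → ∣Top∣ < weightCount G g
  ∣Top∣<weightCount x₀ g = leaves<weightCount G g (leaf ∘ from) (pendant ∘ from)
    (λ eq → Injection.injective (↔⇒↣ (↔-sym Top↔)) (pendant-injective eq))
    (λ i → weight-leaf g (from i)) x₀ (exceeded g)
    where
    from = Inverse.from Top↔

-- The exact value and the case distinction.

χ[mC₆+nP₆+aP₃] : ∀ m n a → 0 < n → 0 < a → IsχLT (m · C 6 ⊕ n · P 6 ⊕ a · P 3) (2 * n + 2 * a + 1)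
χ[mC₆+nP₆+aP₃] m n@(suc n-1) a 0<n 0<a =
  subst (IsχLT G) (eq n a)
    ((f , f-isLocalTotalAntimagic 0<n 0<a , ≤-antisym (weightCount-f≤ 0<n 0<a) (∣Top∣<weightCount x₀ f)) ,
     λ g _ → ∣Top∣<weightCount x₀ g)
  where
  open Construction m n a
  -- Splitting `n` as `suc n-1` makes the equation for `q` definitional and provides the copy `0F`
  -- of P₆ used for `x₀`.
  open Weights (n-1 + a) refl
  x₀ = vP6 0F 0F
  eq : ∀ n a → suc (2 * a + 2 * n) ≡ 2 * n + 2 * a + 1
  eq = solve-∀

theorem4p4 : (m n a : ℕ) → 1 ≤ m → 1 ≤ n → 2 ≤ a →
    ∃[ χ ] (IsχLT (m · C 6 ⊕ n · P 6 ⊕ a · P 3) χ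
      × ((2 * a + 2 ≤ n ⊎ 2 * n ≤ a) → χ ≡ 2 * n + 2 * a + 1)
      × (¬ (2 * a + 2 ≤ n ⊎ 2 * n ≤ a) →
           ((n ≡ 2 * a + 1 ⊎ (n + 1 ≤ a × a ≤ 2 * n ∸ 1)) →
              2 * n + 2 * a + 1 ≤ χ × χ ≤ 2 * n + 2 * a + 2)
         × ((n ≡ 2 * a ⊎ a ≡ n) →
              2 * n + 2 * a + 1 ≤ χ × χ ≤ 2 * n + 2 * a + 3)
         × (((a + 1 ≤ n × n ≤ 2 * a ∸ 1) ⊎ a + 1 ≡ n) →
              2 * n + 2 * a + 1 ≤ χ × χ ≤ 2 * n + 2 * a + 4)
         × ((n ≤ a ⊎ a + 2 ≤ n) →
              2 * n + 2 * a + 1 ≤ χ × χ ≤ 2 * n + 2 * a + 5)))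
theorem4p4 m n a _ 1≤n 2≤a =
  -- The value is the common lower end of all four ranges, so each range only asks that its upper
  -- constant be at least 1.
  2 * n + 2 * a + 1 , χ[mC₆+nP₆+aP₃] m n a 1≤n (≤-trans (s≤s z≤n) 2≤a) , (λ _ → refl) ,
  λ _ → (λ _ → bounds (s≤s z≤n)) , (λ _ → bounds (s≤s z≤n)) , (λ _ → bounds (s≤s z≤n)) , (λ _ → bounds (s≤s z≤n))
  where
  bounds : ∀ {k} → 1 ≤ k → 2 * n + 2 * a + 1 ≤ 2 * n + 2 * a + 1 × 2 * n + 2 * a + 1 ≤ 2 * n + 2 * a + k
  bounds 1≤k = ≤-refl , +-monoʳ-≤ (2 * n + 2 * a) 1≤k
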